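{- Let $\Gamma=(N,A,u)$ be a finite normal form game and let $G\le S_\Gamma$ be player transitive. There exists a matching $M$ of $A_1,\dots,A_n$ such that $M_{\overrightarrow{G}}=G$ if and only if $G$ is strategy trivial.
   Context: $S_\Gamma$ is the group of game bijections $g=(\pi;(\tau_i)_{i\in N})$ from $\Gamma$ to itself ($\pi\in S_N$, bijections $\tau_i:A_i\to A_{\pi(i)}$), with composition $(\eta;(\phi_j))\circ(\pi;(\tau_i))=(\eta\circ\pi;(\phi_{\pi(i)}\circ\tau_i)_{i\in N})$; write $g(i)=\pi(i)$, $g(s_i)=\tau_i(s_i)$. $\overrightarrow{G}\le S_N$ is the set of player permutations of elements of $G$. $G$ is player transitive if $\overrightarrow{G}$ acts transitively on $N$. $G$ is strategy trivial if for each $i\in N$, $g(s_i)=s_i$ for all $g\in G$ with $g(i)=i$ and all $s_i\in A_i$. A matching of $A_1,\dots,A_n$ is $M\subseteq\times_{i\in N}A_i$ such that for each $i$ and $a_i\in A_i$ there is exactly one $s\in M$ with $s_i=a_i$; $M_{ij}:A_i\to A_j$ sends $a_i$ to the unique $a_j$ with some $s\in M$ having $s_i=a_i,s_j=a_j$; $M_\pi=(\pi;(M_{i\pi(i)})_{i\in N})$ and $M_H=\{M_\pi:\pi\in H\}$ for $H\subseteq S_N$. -}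

module Defs where

open import Algebra.Bundles using (Group)
open import Data.Fin.Base using (Fin)
open import Data.Fin.Permutation using (Permutation′; _⟨$⟩ʳ_; _⟨$⟩ˡ_; inverseˡ; inverseʳ) renaming (_≈_ to _≈ₚ_)
open import Data.Nat.Base using (ℕ)
open import Data.Product.Base using (Σ; ∃-syntax; _×_; _,_; proj₁; proj₂)
open import Data.Product using (∃!)
open import Function.Base using (_∘_)
open import Function.Bundles using (_↔_; Inverse; mk↔ₛ′)
open import Function.Construct.Composition using (_↔-∘_)
open import Function.Construct.Identity using (↔-id)
open import Function.Construct.Symmetry using (↔-sym)
open import Level using (Level; 0ℓ; _⊔_) renaming (suc to lsuc)
open import Relation.Binary.Bundles using (Setoid)
open import Relation.Binary.PropositionalEquality using (_≡_; refl; sym; trans; cong; subst; subst-sym-subst; subst-subst-sym)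
open import Relation.Unary using (Pred; _∈_)

record Subgroup {c ℓ} (𝔾 : Group c ℓ) (p : Level) : Set (c ⊔ ℓ ⊔ lsuc p) where
  open Group 𝔾
  field
    Elements  : Pred Carrier p
    resp      : ∀ {x y} → x ≈ y → x ∈ Elements → y ∈ Elements
    ε-closed  : ε ∈ Elements
    ∙-closed  : ∀ {x y} → x ∈ Elements → y ∈ Elements → x ∙ y ∈ Elements
    ⁻¹-closed : ∀ {x} → x ∈ Elements → x ⁻¹ ∈ Elements

Profile : ∀ {n} → (Fin n → Set) → Set
Profile A = ∀ i → A i

-- Equality of profiles is componentwise, as functions are not extensional.
infix 4 _≈ₛ_
_≈ₛ_ : ∀ {n} {A : Fin n → Set} → Profile A → Profile A → Set
s ≈ₛ t = ∀ i → s i ≡ t i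

-- The payoffs lie in an arbitrary setoid; any construction of the real
-- numbers is an instance.
record Game {c ℓ} (Payoff : Setoid c ℓ) : Set (lsuc 0ℓ ⊔ c ⊔ ℓ) where
  open Setoid Payoff using (Carrier; _≈_)
  field
    n      : ℕ
    A      : Fin n → Set
    size   : Fin n → ℕ
    finite : ∀ i → A i ↔ Fin (size i)
    u      : Fin n → Profile A → Carrier
    u-cong : ∀ i {s t} → s ≈ₛ t → u i s ≈ u i t

  N : Set
  N = Fin n

module _ {c ℓ} {Payoff : Setoid c ℓ} (Γ : Game Payoff) where
  open Game Γ

  record GameBijection : Set where
    constructor ⟨_⨾_⟩
    field
      π : Permutation′ n
      τ : ∀ i → A i ↔ A (π ⟨$⟩ʳ i)

  open GameBijection

  -- act g (i , sᵢ) = (g(i) , g(sᵢ)).  Keeping the player next to the strategy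
  -- lets strategies be compared when their players are only provably equal:
  -- since Fin n has unique identity proofs, (i , a) ≡ (i , b) implies a ≡ b.
  act : GameBijection → Σ N A → Σ N A
  act g (i , sᵢ) = π g ⟨$⟩ʳ i , Inverse.to (τ g i) sᵢ

  infix 4 _≈ᵍ_
  record _≈ᵍ_ (g h : GameBijection) : Set where
    constructor _,_
    field
      players    : π g ≈ₚ π h
      strategies : ∀ x → act g x ≡ act h x

  idᵍ : GameBijection
  idᵍ = ⟨ ↔-id N ⨾ (λ i → ↔-id (A i)) ⟩

  infixr 9 _∘ᵍ_
  _∘ᵍ_ : GameBijection → GameBijection → GameBijection
  ⟨ η ⨾ φ ⟩ ∘ᵍ ⟨ π ⨾ τ ⟩ = ⟨ η ↔-∘ π ⨾ (λ i → φ (π ⟨$⟩ʳ i) ↔-∘ τ i) ⟩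

  private
    transport : ∀ {i j} → i ≡ j → A i ↔ A j
    transport eq = mk↔ₛ′ (subst A eq) (subst A (sym eq))
      (λ _ → subst-subst-sym eq) (λ _ → subst-sym-subst eq)

  -- The j-th strategy map is the inverse of τ at π⁻¹(j), whose domain
  -- A (π (π⁻¹ j)) is identified with A j.
  _⁻¹ᵍ : GameBijection → GameBijection
  ⟨ π ⨾ τ ⟩ ⁻¹ᵍ = ⟨ ↔-sym π ⨾ (λ j → ↔-sym (transport (inverseʳ π) ↔-∘ τ (π ⟨$⟩ˡ j))) ⟩

  private
    shift : ∀ {i j} (eq : i ≡ j) (a : A j) → _≡_ {A = Σ N A} (i , subst A (sym eq) a) (j , a)
    shift refl a = refl

    act-inverseʳ : ∀ g x → act g (act (g ⁻¹ᵍ) x) ≡ x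
    act-inverseʳ g (j , a) = trans
      (cong (_ ,_) (Inverse.strictlyInverseˡ (τ g (π g ⟨$⟩ˡ j)) _))
      (shift (inverseʳ (π g)) a)

    pair-injective : ∀ {i} {a b : A i} → _≡_ {A = Σ N A} (i , a) (i , b) → a ≡ b
    pair-injective refl = refl

    act-injective : ∀ g x y → act g x ≡ act g y → x ≡ y
    act-injective g (i , a) (k , b) eq
      with trans (sym (inverseˡ (π g))) (trans (cong ((π g ⟨$⟩ˡ_) ∘ proj₁) eq) (inverseˡ (π g)))
    ... | refl = cong (i ,_) (trans (sym (Inverse.strictlyInverseʳ (τ g i) a))
                   (trans (cong (Inverse.from (τ g i)) (pair-injective eq))
                          (Inverse.strictlyInverseʳ (τ g i) b)))

    act-inverseˡ : ∀ g x → act (g ⁻¹ᵍ) (act g x) ≡ x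
    act-inverseˡ g x = act-injective g _ x (act-inverseʳ g (act g x))

    ⁻¹ᵍ-cong : ∀ {g h} → g ≈ᵍ h → g ⁻¹ᵍ ≈ᵍ h ⁻¹ᵍ
    ⁻¹ᵍ-cong {g} {h} (p , q) =
      (λ i → trans (cong (π g ⟨$⟩ˡ_) (trans (sym (inverseʳ (π h))) (sym (p _)))) (inverseˡ (π g))) ,
      (λ x → act-injective g _ _ (trans (act-inverseʳ g x)
               (trans (sym (act-inverseʳ h x)) (sym (q _)))))

  S : Group 0ℓ 0ℓ
  S = record
    { Carrier = GameBijection
    ; _≈_     = _≈ᵍ_
    ; _∙_     = _∘ᵍ_
    ; ε       = idᵍ
    ; _⁻¹     = _⁻¹ᵍ
    ; isGroup = record
      { isMonoid = record
        { isSemigroup = record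
          { isMagma = record
            { isEquivalence = record
              { refl  = (λ _ → refl) , (λ _ → refl)
              ; sym   = λ (p , q) → (λ i → sym (p i)) , (λ x → sym (q x))
              ; trans = λ (p , q) (p′ , q′) → (λ i → trans (p i) (p′ i)) , (λ x → trans (q x) (q′ x))
              }
            ; ∙-cong = λ {g} {g′} (p , q) (p′ , q′) →
                (λ i → trans (cong (π g ⟨$⟩ʳ_) (p′ i)) (p _)) ,
                (λ x → trans (cong (act g) (q′ x)) (q _))
            }
          ; assoc = λ _ _ _ → (λ _ → refl) , (λ _ → refl)
          }
        ; identity = (λ _ → (λ _ → refl) , (λ _ → refl)) , (λ _ → (λ _ → refl) , (λ _ → refl))
        }
      ; inverse = (λ g → (λ i → inverseˡ (π g)) , act-inverseˡ g) , (λ g → (λ i → inverseʳ (π g)) , act-inverseʳ g)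
      ; ⁻¹-cong = ⁻¹ᵍ-cong
      }
    }

  record Matching : Set₁ where
    field
      Elements : Pred (Profile A) 0ℓ
      resp     : ∀ {s t} → s ≈ₛ t → s ∈ Elements → t ∈ Elements
      matches  : ∀ i (a : A i) → ∃! _≈ₛ_ (λ s → s ∈ Elements × s i ≡ a)

  module _ (M : Matching) where
    open Matching M

    -- M_{ij}: the j-th component of the unique s ∈ M with sᵢ = a.
    match : ∀ i j → A i → A j
    match i j a = proj₁ (matches i a) j

    private
      match-inverse : ∀ i j (a : A i) → match j i (match i j a) ≡ a
      match-inverse i j a with matches i a
      ... | s , (s∈M , sᵢ≡a) , _ with matches j (s j)
      ... | t , _ , unique = trans (unique (s∈M , refl) i) sᵢ≡a

    match↔ : ∀ i j → A i ↔ A j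
    match↔ i j = mk↔ₛ′ (match i j) (match j i) (match-inverse j i) (match-inverse i j)

    matchBijection : Permutation′ n → GameBijection
    matchBijection π = ⟨ π ⨾ (λ i → match↔ i (π ⟨$⟩ʳ i)) ⟩

    matchBijections : ∀ {p} → Pred (Permutation′ n) p → Pred GameBijection p
    matchBijections H g = ∃[ π ] (π ∈ H × g ≈ᵍ matchBijection π)

  module _ {p} (G : Subgroup S p) where
    open Subgroup G

    playerPermutations : Pred (Permutation′ n) p
    playerPermutations ρ = ∃[ g ] (g ∈ Elements × π g ≈ₚ ρ)

    PlayerTransitive : Set p
    PlayerTransitive = ∀ i j → ∃[ ρ ] (ρ ∈ playerPermutations × ρ ⟨$⟩ʳ i ≡ j)

    StrategyTrivial : Set p
    StrategyTrivial = ∀ i g → g ∈ Elements → π g ⟨$⟩ʳ i ≡ i → ∀ (sᵢ : A i) → act g (i , sᵢ) ≡ (i , sᵢ)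

{-# OPTIONS --safe #-}

-- If G is strategy trivial, the action of g ∈ G on A i depends only on the
-- player g(i), because h⁻¹ g fixes i whenever g(i) = h(i).  By transitivity this
-- gives one bijection A i → A j for every i and j; these are compatible under
-- composition, and the profiles they preserve form the required matching.
-- Conversely M i i is the identity for every matching M.
module Submission where

open import Defs
open import Algebra.Bundles using (Group)
open import Data.Fin.Permutation using (_⟨$⟩ʳ_; _⟨$⟩ˡ_; inverseˡ)
open import Data.Product.Base using (∃-syntax; _×_; _,_; proj₁; proj₂)
open import Data.Product.Properties.WithK using (,-injectiveʳ)
open import Function.Bundles using (_⇔_; mk⇔)
open import Relation.Binary.Bundles using (Setoid)
open import Relation.Binary.PropositionalEquality using (_≡_; refl; sym; trans; cong; module ≡-Reasoning)
open import Relation.Unary using (_≐_; _∈_)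

open GameBijection
open _≈ᵍ_

module _ {c ℓ} {Payoff : Setoid c ℓ} (Γ : Game Payoff) where
  open Game Γ
  open Group (S Γ) using (_⁻¹; _∙_; inverseʳ) renaming (sym to ≈ᵍ-sym; trans to ≈ᵍ-trans)

  match-self : ∀ (M : Matching Γ) i a → match Γ M i i a ≡ a
  match-self M i a = proj₂ (proj₁ (proj₂ (Matching.matches M i a)))

  act-matchBijection-fixed : ∀ (M : Matching Γ) ρ i → ρ ⟨$⟩ʳ i ≡ i → ∀ a →
    -- `cong` over the pair moves the player and the target of `match` along `ρi≡i` together, so no
    -- transport of strategies arises.
    act Γ (matchBijection Γ M ρ) (i , a) ≡ (i , a)
  act-matchBijection-fixed M ρ i ρi≡i a = trans
    (cong (λ j → j , match Γ M i j a) ρi≡i) (cong (i ,_) (match-self M i a))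

  module _ {p} (G : Subgroup (S Γ) p) where
    open Subgroup G

    matching⇒strategyTrivial : ∀ M →
      matchBijections Γ M (playerPermutations Γ G) ≐ Elements → StrategyTrivial Γ G
    matching⇒strategyTrivial M (_ , G⊆M) i g g∈G gi≡i a with G⊆M g∈G
    ... | ρ , _ , g≈Mρ = trans (strategies g≈Mρ (i , a))
      (act-matchBijection-fixed M ρ i (trans (sym (players g≈Mρ i)) gi≡i) a)

    module _ (transitive : PlayerTransitive Γ G) (trivial : StrategyTrivial Γ G) where

      act-determined : ∀ {g h} → g ∈ Elements → h ∈ Elements → ∀ i → π g ⟨$⟩ʳ i ≡ π h ⟨$⟩ʳ i →
        ∀ a → act Γ g (i , a) ≡ act Γ h (i , a)
      act-determined {g} {h} g∈G h∈G i gi≡hi a = begin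
        -- Composites act definitionally as composed actions, so this inserts `h ∙ h ⁻¹` in front of
        -- `g`.
        act Γ g (i , a)                      ≡⟨ strategies (inverseʳ h) _ ⟨
        act Γ h (act Γ (h ⁻¹ ∙ g) (i , a))   ≡⟨ cong (act Γ h) (trivial i (h ⁻¹ ∙ g) (∙-closed (⁻¹-closed h∈G) g∈G) fixed a) ⟩
        act Γ h (i , a)                      ∎
        where
        open ≡-Reasoning
        fixed : π (h ⁻¹ ∙ g) ⟨$⟩ʳ i ≡ i
        fixed = trans (cong (π h ⟨$⟩ˡ_) gi≡hi) (inverseˡ (π h))

      carrier : ∀ i j → ∃[ g ] (g ∈ Elements × π g ⟨$⟩ʳ i ≡ j)
      carrier i j with transitive i j
      ... | ρ , (g , g∈G , g≈ρ) , ρi≡j = g , g∈G , trans (g≈ρ i) ρi≡j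

      -- Quantifying over all `g` frees later arguments from the chosen carrier `h`. Matching its
      -- equation with `refl` turns `j` into the image of `i` under `h`, so `h` sends `a` into `A j`
      -- without a transport.
      commonImage : ∀ i j (a : A i) →
        ∃[ b ] (∀ {g} → g ∈ Elements → π g ⟨$⟩ʳ i ≡ j → act Γ g (i , a) ≡ (j , b))
      commonImage i j a with carrier i j
      ... | h , h∈G , refl = _ , λ g∈G gi≡hi → act-determined g∈G h∈G i gi≡hi a

      transfer : ∀ i j → A i → A j
      transfer i j a = proj₁ (commonImage i j a)

      act≡transfer : ∀ {g} → g ∈ Elements → ∀ {i j} → π g ⟨$⟩ʳ i ≡ j → ∀ a →
        act Γ g (i , a) ≡ (j , transfer i j a)
      act≡transfer g∈G {i} {j} gi≡j a = proj₂ (commonImage i j a) g∈G gi≡j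

      transfer-self : ∀ i a → transfer i i a ≡ a
      transfer-self i a = sym (,-injectiveʳ (act≡transfer ε-closed refl a))

      -- If `g` carries `i` to `j` and `h` carries `j` to `k`, then `h ∙ g` lies in `G` and can
      -- compute `transfer i k`, even if `carrier i k` is another element.
      transfer-transfer : ∀ i j k a → transfer j k (transfer i j a) ≡ transfer i k a
      transfer-transfer i j k a =
        let g , g∈G , gi≡j = carrier i j
            h , h∈G , hj≡k = carrier j k
        in ,-injectiveʳ (begin
          k , transfer j k (transfer i j a)   ≡⟨ act≡transfer h∈G hj≡k _ ⟨
          act Γ h (j , transfer i j a)        ≡⟨ cong (act Γ h) (act≡transfer g∈G gi≡j a) ⟨
          act Γ (h ∙ g) (i , a)               ≡⟨ act≡transfer (∙-closed h∈G g∈G) (trans (cong (π h ⟨$⟩ʳ_) gi≡j) hj≡k) a ⟩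
          k , transfer i k a                  ∎)
        where open ≡-Reasoning

      transferMatching : Matching Γ
      transferMatching = record
        { Elements = λ s → ∀ i j → transfer i j (s i) ≡ s j
        ; resp     = λ s≈t s∈M i j → trans (cong (transfer i j) (sym (s≈t i))) (trans (s∈M i j) (s≈t j))
        ; matches  = λ i a → (λ j → transfer i j a)
            , ((λ j k → transfer-transfer i j k a) , transfer-self i a)
            -- Uniqueness: the compatibility equations starting at `i` determine every component
            -- from `a`.
            , λ (s∈M , sᵢ≡a) j → trans (cong (transfer i j) (sym sᵢ≡a)) (s∈M i j)
        }

      -- Serves both inclusions; `ρ` is separate from `π g` because membership in
      -- `playerPermutations` gives only pointwise agreement.
      ≈ᵍ-matchBijection : ∀ {g ρ} → g ∈ Elements → (∀ i → π g ⟨$⟩ʳ i ≡ ρ ⟨$⟩ʳ i) →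
        _≈ᵍ_ Γ g (matchBijection Γ transferMatching ρ)
      ≈ᵍ-matchBijection g∈G g≈ρ = g≈ρ , λ (i , a) → act≡transfer g∈G (g≈ρ i) a

      transferMatching-generates :
        matchBijections Γ transferMatching (playerPermutations Γ G) ≐ Elements
      transferMatching-generates =
        -- The witness `h` for `ρ` already equals the matching bijection of `ρ`, hence `g`, so
        -- `resp` puts `g` in `G`.
        (λ (ρ , (h , h∈G , h≈ρ) , g≈Mρ) →
          resp (≈ᵍ-trans (≈ᵍ-matchBijection {ρ = ρ} h∈G h≈ρ) (≈ᵍ-sym g≈Mρ)) h∈G) ,
        (λ {g} g∈G → π g , (g , g∈G , λ _ → refl) , ≈ᵍ-matchBijection g∈G (λ _ → refl))

theorem4p23 : ∀ {c ℓ p} {Payoff : Setoid c ℓ} (Γ : Game Payoff) (G : Subgroup (S Γ) p) →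
    PlayerTransitive Γ G →
    (∃[ M ] (matchBijections Γ M (playerPermutations Γ G) ≐ Subgroup.Elements G)) ⇔ StrategyTrivial Γ G
theorem4p23 Γ G transitive = mk⇔
  (λ (M , M≐G) → matching⇒strategyTrivial Γ G M M≐G)
  (λ trivial → transferMatching Γ G transitive trivial , transferMatching-generates Γ G transitive trivial)
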